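{- Let $(\mathcal{A},\mathbf{m})$ be a cyclic sequencing problem with a binary alphabet, i.e. $\mathcal{A}=[a_1,a_2]$ and $\mathbf{m}=(m_1,m_2)\in\mathbb{N}^2$. Then the cycle $C\in\Omega(\mathcal{A},\mathbf{m})$ returned by the Euclidean Sequencing Algorithm minimizes variance, that is, $\sigma^2(C)\le\sigma^2(C')$ for every $C'\in\Omega(\mathcal{A},\mathbf{m})$.
   Context: Here $\mathbb{N}=\{1,2,\ldots\}$. A cyclic sequencing problem is a couple $(\mathcal{A},\mathbf{m})$, where $\mathcal{A}=[a_1,\ldots,a_n]$ is an alphabet of $n$ distinct symbols and $\mathbf{m}=(m_1,\ldots,m_n)\in\mathbb{N}^n$ is the vector of prescribed multiplicities. Put $N:=\sum_{k=1}^n m_k$ and $\mathbb{Z}_N:=\mathbb{Z}/N\mathbb{Z}$. A cycle is a map $C:\mathbb{Z}_N\to\mathcal{A}$, with $C_j:=C([j]_N)$; it is admissible if $|C^{ -1}(a_k)|=m_k$ for all $k$, and $\Omega(\mathcal{A},\mathbf{m})$ is the set of admissible cycles. A word of length $N$ over $\mathcal{A}$ is identified with the cycle whose values $C_1,\ldots,C_N$ are its successive letters. For a cycle $C$ and a position $j$, $\Delta_j$ is the distance in steps from position $j$ to the next instance of the same symbol around the cycle, i.e. the least integer $d\ge 1$ with $C_{j+d}=C_j$ (indices modulo $N$); so $\Delta_j=N$ if the symbol appears only once. The mean is $\mu(C):=\frac1N\sum_{j=1}^N\Delta_j$ and the variance is $\sigma^2(C):=\frac1N\sum_{j=1}^N(\Delta_j-\mu(C))^2$.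 Euclidean Sequencing Algorithm (ESA), for $n=2$. Words are multiplied by concatenation, and $W^q$ is the $q$-fold concatenation of $W$. Let $A_0$ be the symbol of higher multiplicity and $B_0$ the other one (if $m_1=m_2$, either choice is allowed); let $P_1$ and $D_1$ be the multiplicities of $A_0$ and $B_0$. For $i=1,2,\ldots$ set $Q_i:=\lfloor P_i/D_i\rfloor$, $R_i:=P_i-Q_iD_i$, $A_i:=A_{i-1}^{Q_i}B_{i-1}$, $B_i:=A_{i-1}$. If $R_i>0$, set $P_{i+1}:=D_i$, $D_{i+1}:=R_i$ and continue with $i+1$; if $R_i=0$, stop and return the cycle $C:=A_i^{D_i}$. -}

module Defs where

open import Algebra.Properties.CommutativeMonoid.Sum using (sum)
open import Data.Fin.Base using (Fin; zero; suc; toℕ; cast; opposite)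
open import Data.Fin.Properties as Fin using (toℕ-injective; toℕ-fromℕ<; toℕ<n)
import Data.Integer.Base as ℤ
open import Data.List.Base
  using (List; [_]; _++_; length; filter; allFin; replicate; concat; lookup)
open import Data.List.Properties using (length-++)
open import Data.Nat.Base as ℕ
  using (ℕ; zero; suc; _+_; _*_; _≤_; _<_; z≤n; s≤s; NonZero)
open import Data.Nat.DivMod
  using (_/_; _%_; _mod_; m%n<n; m<n⇒m%n≡m; [m+n]%n≡m%n; m≡m%n+[m/n]*n)
open import Data.Nat.Induction using (Acc; acc; <-wellFounded)
open import Data.Nat.Properties as ℕ
  using (+-identityʳ; *-identityʳ; +-comm; m≤m+n; <-≤-trans)
open import Data.Nat.Solver using (module +-*-Solver)
open import Data.Product.Base using (∃; _×_; _,_; proj₁)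
open import Data.Rational.Base as ℚ using (ℚ)
import Data.Rational.Properties as ℚ
open import Function.Base using (_∘_)
open import Function.Bundles using (_↔_; Inverse)
open import Function.Properties.Inverse using (↔-sym; Inverse⇒Injection)
open import Relation.Binary.Definitions using (DecidableEquality)
open import Relation.Binary.PropositionalEquality
  using (_≡_; refl; sym; trans; cong; cong₂; module ≡-Reasoning)
open import Relation.Nullary using (¬_; yes; no; contradiction)
open import Relation.Nullary.Decidable using (_×-dec_; via-injection)
open import Relation.Unary using (Pred; Decidable)
open import Level using (0ℓ)

∑ℕ : ∀ {n} → (Fin n → ℕ) → ℕ
∑ℕ = sum ℕ.+-0-commutativeMonoid

∑ℚ : ∀ {n} → (Fin n → ℚ) → ℚ
∑ℚ = sum ℚ.+-0-commutativeMonoid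

∑ℕ-nonZero : ∀ {n} .{{_ : NonZero n}} (m : Fin n → ℕ) →
             (∀ k → NonZero (m k)) → NonZero (∑ℕ m)
∑ℕ-nonZero {suc n} m pos =
  ℕ.>-nonZero (<-≤-trans (ℕ.>-nonZero⁻¹ (m zero) {{pos zero}}) (m≤m+n (m zero) _))

least : {P : Pred ℕ 0ℓ} → Decidable P → ∀ n → P n →
        ∃ λ d → P d × (∀ {e} → e < d → ¬ P e)
least P? n pn with P? 0
least P? n       pn | yes p0 = 0 , p0 , λ ()
least P? zero    pn | no ¬p0 = contradiction pn ¬p0
least P? (suc n) pn | no ¬p0 with least (P? ∘ suc) n pn
... | d , pd , min = suc d , pd , λ { {zero} _ → ¬p0 ; {suc e} (s≤s e<d) → min e<d }

-- ℤ/N is represented by Fin N, with i : Fin N standing for the class of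
-- toℕ i + 1 (i.e. the representatives are 1, …, N).  Thus index zero is
-- position 1, and a word of length N is the cycle given by list lookup.

infixl 6 _⊕_

_⊕_ : ∀ {N} .{{_ : NonZero N}} → Fin N → ℕ → Fin N
_⊕_ {N} j d = (toℕ j + d) mod N

⊕-period : ∀ {N} .{{_ : NonZero N}} (j : Fin N) → j ⊕ N ≡ j
⊕-period {N} j = toℕ-injective (begin
  toℕ (j ⊕ N)      ≡⟨ toℕ-fromℕ< (m%n<n (toℕ j + N) N) ⟩
  (toℕ j + N) % N  ≡⟨ [m+n]%n≡m%n (toℕ j) N ⟩
  toℕ j % N        ≡⟨ m<n⇒m%n≡m (toℕ<n j) ⟩
  toℕ j            ∎)
  where open ≡-Reasoning

record CyclicSequencingProblem (n : ℕ) .{{_ : NonZero n}} : Set₁ where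
  field
    Symbol   : Set
    alphabet : Fin n ↔ Symbol
    m        : Fin n → ℕ
    m-pos    : ∀ k → NonZero (m k)

  a : Fin n → Symbol
  a = Inverse.to alphabet

  _≟_ : DecidableEquality Symbol
  _≟_ = via-injection (Inverse⇒Injection (↔-sym alphabet)) Fin._≟_

  N : ℕ
  N = ∑ℕ m

  instance
    N-nonZero : NonZero N
    N-nonZero = ∑ℕ-nonZero m m-pos

  Cycle : Set
  Cycle = Fin N → Symbol

  Ω : Pred Cycle 0ℓ
  Ω C = ∀ k → length (filter (λ j → C j ≟ a k) (allFin N)) ≡ m k

  nextInstance : (C : Cycle) (j : Fin N) →
    ∃ λ d → (1 ≤ d × C (j ⊕ d) ≡ C j) × (∀ {e} → e < d → ¬ (1 ≤ e × C (j ⊕ e) ≡ C j))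
  nextInstance C j =
    least (λ d → (1 ℕ.≤? d) ×-dec (C (j ⊕ d) ≟ C j))
          N (ℕ.>-nonZero⁻¹ N , cong C (⊕-period j))

  Δ : Cycle → Fin N → ℕ
  Δ C j = proj₁ (nextInstance C j)

  Δℚ : Cycle → Fin N → ℚ
  Δℚ C j = ℤ.+ Δ C j ℚ./ 1

  μ : Cycle → ℚ
  μ C = (ℤ.+ 1 ℚ./ N) ℚ.* ∑ℚ (Δℚ C)

  σ² : Cycle → ℚ
  σ² C = (ℤ.+ 1 ℚ./ N) ℚ.* ∑ℚ (λ j → (Δℚ C j ℚ.- μ C) ℚ.* (Δℚ C j ℚ.- μ C))

infixr 8 _^_

_^_ : {S : Set} → List S → ℕ → List S
W ^ q = concat (replicate q W)

length-^ : {S : Set} (W : List S) (q : ℕ) → length (W ^ q) ≡ q * length W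
length-^ W zero    = refl
length-^ W (suc q) = trans (length-++ W) (cong (length W +_) (length-^ W q))

-- One call performs the i-th round, on A = Aᵢ₋₁, B = Bᵢ₋₁, P = Pᵢ, D = Dᵢ;
-- the accessibility argument only serves termination (Dᵢ₊₁ = Rᵢ < Dᵢ).

rounds : {S : Set} (A B : List S) (P D : ℕ) .{{_ : NonZero D}} → Acc _<_ D → List S
rounds A B P D (acc rs) with P % D | m%n<n P D
... | zero  | _   = (A ^ (P / D) ++ B) ^ D
... | suc R | R<D = rounds (A ^ (P / D) ++ B) A D (suc R) (rs R<D)

length-rounds : {S : Set} (A B : List S) (P D : ℕ) .{{_ : NonZero D}} (ac : Acc _<_ D) →
                length (rounds A B P D ac) ≡ P * length A + D * length B
length-rounds A B P D (acc rs) with P % D | m%n<n P D | m≡m%n+[m/n]*n P D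
... | zero | _ | P≡ = begin
  length ((A ^ Q ++ B) ^ D)              ≡⟨ length-^ (A ^ Q ++ B) D ⟩
  D * length (A ^ Q ++ B)                ≡⟨ cong (D *_) (length-++ (A ^ Q)) ⟩
  D * (length (A ^ Q) + length B)        ≡⟨ cong (λ l → D * (l + length B)) (length-^ A Q) ⟩
  D * (Q * length A + length B)          ≡⟨ solve 4 (λ d q x y → d :* (q :* x :+ y) := (q :* d) :* x :+ d :* y)
                                              refl D Q (length A) (length B) ⟩
  Q * D * length A + D * length B        ≡⟨ cong (λ p → p * length A + D * length B) (sym P≡) ⟩
  P * length A + D * length B            ∎
  where
  open ≡-Reasoning
  open +-*-Solver
  Q = P / D
... | suc R | R<D | P≡ = begin
  length (rounds (A ^ Q ++ B) A D (suc R) (rs R<D))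
    ≡⟨ length-rounds (A ^ Q ++ B) A D (suc R) (rs R<D) ⟩
  D * length (A ^ Q ++ B) + suc R * length A
    ≡⟨ cong (λ l → D * l + suc R * length A) (length-++ (A ^ Q)) ⟩
  D * (length (A ^ Q) + length B) + suc R * length A
    ≡⟨ cong (λ l → D * (l + length B) + suc R * length A) (length-^ A Q) ⟩
  D * (Q * length A + length B) + suc R * length A
    ≡⟨ solve 5 (λ d q x y r → d :* (q :* x :+ y) :+ r :* x := (r :+ q :* d) :* x :+ d :* y)
         refl D Q (length A) (length B) (suc R) ⟩
  (suc R + Q * D) * length A + D * length B
    ≡⟨ cong (λ p → p * length A + D * length B) (sym P≡) ⟩
  P * length A + D * length B ∎
  where
  open ≡-Reasoning
  open +-*-Solver
  Q = P / D

module ESA (𝒫 : CyclicSequencingProblem 2) where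
  open CyclicSequencingProblem 𝒫

  -- The index k selects A₀ = aₖ; opposite k is the other index.  When the two
  -- multiplicities agree, both values of k satisfy the condition.

  IsLeading : Fin 2 → Set
  IsLeading k = m (opposite k) ≤ m k

  word : (k : Fin 2) → IsLeading k → List Symbol
  word k _ = rounds [ a k ] [ a (opposite k) ] (m k) (m (opposite k))
                    {{m-pos (opposite k)}} (<-wellFounded _)

  length-word : ∀ k (h : IsLeading k) → length (word k h) ≡ N
  length-word k h = trans
    (length-rounds [ a k ] [ a (opposite k) ] (m k) (m (opposite k))
                   {{m-pos (opposite k)}} (<-wellFounded _))
    (trans (cong₂ _+_ (*-identityʳ (m k)) (*-identityʳ (m (opposite k)))) (order k))
    where
    order : ∀ k → m k + m (opposite k) ≡ N
    order zero       = cong (m zero +_) (sym (+-identityʳ _))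
    order (suc zero) = trans (+-comm (m (suc zero)) (m zero)) (order zero)

  cycle : (k : Fin 2) → IsLeading k → Cycle
  cycle k h j = lookup (word k h) (cast (sym (length-word k h)) j)

{-# OPTIONS --safe #-}

-- For each symbol the gaps Δⱼ over its instances add up to N, so the mean is
-- the same for all admissible cycles and only the sums of Δⱼ² have to be
-- compared.  By Δ² + q(q+1) ≥ (2q+1)Δ, with equality iff Δ ∈ {q, q+1}, a cycle
-- in which each symbol has gaps of at most two consecutive sizes is optimal.
-- The ESA cycle is of this kind: being a concatenation of blocks A₀^Q₁ B₀ and
-- A₀, the latter never adjacent to each other, it has gaps in {1, 2} for A₀ and
-- in {Q₁+1, Q₁+2} for B₀.

module Submission where

open import Defs
open import Data.Fin.Base using (Fin; zero; suc; toℕ; cast; opposite)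
open import Data.Fin.Permutation using (permutation)
open import Data.Fin.Properties
  using (any?; suc-injective; toℕ-injective; toℕ-fromℕ<; toℕ<n; toℕ-cast; cast-is-id; 0≢1+n)
import Data.Integer.Base as ℤ
import Data.Integer.Properties as ℤ
open import Data.List.Base
  using (List; []; _∷_; [_]; _++_; length; filter; allFin; lookup; tabulate)
open import Data.List.Properties
  using (filter-none; filter-accept; filter-reject; filter-++; length-++; tabulate-cong; tabulate-lookup)
open import Data.List.Relation.Unary.All using (universal)
open import Data.Nat.Base
  using (ℕ; zero; suc; pred; _+_; _*_; _∸_; _<_; z≤n; s≤s; NonZero; >-nonZero; ≢-nonZero⁻¹)
  renaming (_≤_ to _≤ℕ_)
open import Data.Nat.DivMod
  using (_/_; _%_; m%n<n; m<n⇒m%n≡m; n%n≡0; [m+n]%n≡m%n; m%n%n≡m%n; %-distribˡ-+; m≡m%n+[m/n]*n; m≥n⇒m/n>0)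
open import Data.Nat.Induction using (Acc; acc; <-wellFounded)
import Data.Nat.Properties as ℕ
import Data.Nat.Solver as ℕ
open import Data.Product.Base using (∃; _×_; _,_; proj₁; proj₂)
open import Data.Rational.Base as ℚ using (ℚ; _≤_)
import Data.Rational.Properties as ℚ
import Data.Rational.Solver as ℚ
import Data.Rational.Unnormalised.Base as ℚᵘ
import Data.Rational.Unnormalised.Properties as ℚᵘ
open import Data.Sum.Base as Sum using (_⊎_; inj₁; inj₂)
open import Function.Base using (_∘_; id)
open import Function.Bundles using (Inverse)
open import Level using (0ℓ)
open import Relation.Binary.Definitions using (tri<; tri≈; tri>)
open import Relation.Binary.PropositionalEquality
  using (_≡_; _≢_; refl; sym; trans; cong; cong₂; subst; subst₂; module ≡-Reasoning)
open import Relation.Nullary using (¬_; Dec; yes; no; contradiction)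
open import Relation.Unary using (Pred; Decidable; _∈_)

open import Algebra.Properties.CommutativeMonoid.Sum ℕ.+-0-commutativeMonoid
  using (∑-distrib-+; ∑-comm; sum-permute; sum-cong-≗)
open import Algebra.Properties.Semiring.Sum ℕ.+-*-semiring using (*-distribˡ-sum)

-- Finite sums

∑-mono-≤ : ∀ {n} {f g : Fin n → ℕ} → (∀ i → f i ≤ℕ g i) → ∑ℕ f ≤ℕ ∑ℕ g
∑-mono-≤ {zero}  f≤g = ℕ.≤-refl
∑-mono-≤ {suc n} f≤g = ℕ.+-mono-≤ (f≤g zero) (∑-mono-≤ (f≤g ∘ suc))

∑-suc : ∀ {n} (f : Fin n → ℕ) → ∑ℕ (suc ∘ f) ≡ n + ∑ℕ f
∑-suc {zero}  f = refl
∑-suc {suc n} f = cong suc (begin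
  f zero + ∑ℕ (suc ∘ f ∘ suc)    ≡⟨ cong (f zero +_) (∑-suc (f ∘ suc)) ⟩
  f zero + (n + ∑ℕ (f ∘ suc))    ≡⟨ solve 3 (λ x y z → x :+ (y :+ z) := y :+ (x :+ z)) refl (f zero) n _ ⟩
  n + (f zero + ∑ℕ (f ∘ suc))    ∎)
  where
  open ≡-Reasoning
  open ℕ.+-*-Solver

∑-zero : ∀ {n} {f : Fin n → ℕ} → (∀ i → f i ≡ 0) → ∑ℕ f ≡ 0
∑-zero {zero}  f≡0 = refl
∑-zero {suc n} f≡0 = cong₂ _+_ (f≡0 zero) (∑-zero (f≡0 ∘ suc))

∑-single : ∀ {n} (f : Fin n → ℕ) i → (∀ k → k ≢ i → f k ≡ 0) → ∑ℕ f ≡ f i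
∑-single f zero    f≡0 =
  trans (cong (f zero +_) (∑-zero (λ k → f≡0 (suc k) (0≢1+n ∘ sym)))) (ℕ.+-identityʳ _)
∑-single f (suc i) f≡0 =
  cong₂ _+_ (f≡0 zero 0≢1+n)
    (∑-single (f ∘ suc) i (λ k k≢i → f≡0 (suc k) (k≢i ∘ suc-injective)))

-- Natural numbers in the rationals, and sums of squared deviations

fromℕ : ℕ → ℚ
fromℕ n = ℤ.+ n ℚ./ 1

-- Normalisation blocks computation on variables; the homomorphism laws below are therefore checked
-- on unnormalised fractions with denominator 1.
toℚᵘ-fromℕ : ∀ n → ℚ.toℚᵘ (fromℕ n) ℚᵘ.≃ ℚᵘ.mkℚᵘ (ℤ.+ n) 0
toℚᵘ-fromℕ n = ℚ.toℚᵘ-fromℚᵘ (ℚᵘ.mkℚᵘ (ℤ.+ n) 0)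

fromℕ-+ : ∀ m n → fromℕ (m + n) ≡ fromℕ m ℚ.+ fromℕ n
fromℕ-+ m n = ℚ.toℚᵘ-injective (begin
  ℚ.toℚᵘ (fromℕ (m + n))
    ≈⟨ toℚᵘ-fromℕ (m + n) ⟩
  ℚᵘ.mkℚᵘ (ℤ.+ (m + n)) 0
    ≈⟨ ℚᵘ.*≡* (cong (ℤ._* ℤ.1ℤ) (sym (cong₂ ℤ._+_ (ℤ.*-identityʳ (ℤ.+ m)) (ℤ.*-identityʳ (ℤ.+ n))))) ⟩
  ℚᵘ.mkℚᵘ (ℤ.+ m) 0 ℚᵘ.+ ℚᵘ.mkℚᵘ (ℤ.+ n) 0
    ≈⟨ ℚᵘ.+-cong (toℚᵘ-fromℕ m) (toℚᵘ-fromℕ n) ⟨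
  ℚ.toℚᵘ (fromℕ m) ℚᵘ.+ ℚ.toℚᵘ (fromℕ n)
    ≈⟨ ℚ.toℚᵘ-homo-+ (fromℕ m) (fromℕ n) ⟨
  ℚ.toℚᵘ (fromℕ m ℚ.+ fromℕ n) ∎)
  where open import Relation.Binary.Reasoning.Setoid ℚᵘ.≃-setoid

fromℕ-* : ∀ m n → fromℕ (m * n) ≡ fromℕ m ℚ.* fromℕ n
fromℕ-* m n = ℚ.toℚᵘ-injective (begin
  ℚ.toℚᵘ (fromℕ (m * n))
    ≈⟨ toℚᵘ-fromℕ (m * n) ⟩
  ℚᵘ.mkℚᵘ (ℤ.+ (m * n)) 0
    ≈⟨ ℚᵘ.*≡* (cong (ℤ._* ℤ.1ℤ) (ℤ.pos-* m n)) ⟩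
  ℚᵘ.mkℚᵘ (ℤ.+ m) 0 ℚᵘ.* ℚᵘ.mkℚᵘ (ℤ.+ n) 0
    ≈⟨ ℚᵘ.*-cong (toℚᵘ-fromℕ m) (toℚᵘ-fromℕ n) ⟨
  ℚ.toℚᵘ (fromℕ m) ℚᵘ.* ℚ.toℚᵘ (fromℕ n)
    ≈⟨ ℚ.toℚᵘ-homo-* (fromℕ m) (fromℕ n) ⟨
  ℚ.toℚᵘ (fromℕ m ℚ.* fromℕ n) ∎)
  where open import Relation.Binary.Reasoning.Setoid ℚᵘ.≃-setoid

fromℕ-mono-≤ : ∀ {m n} → m ≤ℕ n → fromℕ m ≤ fromℕ n
fromℕ-mono-≤ {m} {n} m≤n = ℚ.toℚᵘ-cancel-≤
  (ℚᵘ.≤-respˡ-≃ (ℚᵘ.≃-sym (toℚᵘ-fromℕ m)) (ℚᵘ.≤-respʳ-≃ (ℚᵘ.≃-sym (toℚᵘ-fromℕ n))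
    (ℚᵘ.*≤* (ℤ.*-monoʳ-≤-nonNeg ℤ.1ℤ (ℤ.+≤+ m≤n)))))

-- `Δℚ C` unfolds to `fromℕ ∘ Δ C`, so this carries the sum in the mean over to natural numbers.
∑-fromℕ : ∀ {n} (f : Fin n → ℕ) → ∑ℚ (fromℕ ∘ f) ≡ fromℕ (∑ℕ f)
∑-fromℕ {zero}  f = refl
∑-fromℕ {suc n} f = trans (cong (fromℕ (f zero) ℚ.+_) (∑-fromℕ (f ∘ suc))) (sym (fromℕ-+ (f zero) _))

-- Each square is expanded, with `c + c` for twice `c`. The result depends on `f` only through the
-- sum and the sum of squares, for an arbitrary centre `c`.
∑-deviation² : ∀ {n} (f : Fin n → ℕ) c →
  ∑ℚ (λ i → (fromℕ (f i) ℚ.- c) ℚ.* (fromℕ (f i) ℚ.- c)) ≡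
  fromℕ (∑ℕ (λ i → f i * f i)) ℚ.+ (fromℕ n ℚ.* (c ℚ.* c) ℚ.- (c ℚ.+ c) ℚ.* fromℕ (∑ℕ f))
∑-deviation² {zero}  f c =
  solve 1 (λ c → con ℚ.0ℚ := con ℚ.0ℚ :+ (con ℚ.0ℚ :* (c :* c) :- (c :+ c) :* con ℚ.0ℚ)) refl c
  where open ℚ.+-*-Solver
∑-deviation² {suc n} f c = begin
  (x ℚ.- c) ℚ.* (x ℚ.- c) ℚ.+ ∑ℚ (λ i → (fromℕ (f (suc i)) ℚ.- c) ℚ.* (fromℕ (f (suc i)) ℚ.- c))
    ≡⟨ cong ((x ℚ.- c) ℚ.* (x ℚ.- c) ℚ.+_) (∑-deviation² (f ∘ suc) c) ⟩
  (x ℚ.- c) ℚ.* (x ℚ.- c) ℚ.+ (s ℚ.+ (fromℕ n ℚ.* (c ℚ.* c) ℚ.- (c ℚ.+ c) ℚ.* t))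
    ≡⟨ rearrange x c s (fromℕ n) t ⟩
  (x ℚ.* x ℚ.+ s) ℚ.+ ((ℚ.1ℚ ℚ.+ fromℕ n) ℚ.* (c ℚ.* c) ℚ.- (c ℚ.+ c) ℚ.* (x ℚ.+ t))
    ≡⟨ cong₂ ℚ._+_ ∑f²≡ (cong₂ (λ y z → y ℚ.* (c ℚ.* c) ℚ.- (c ℚ.+ c) ℚ.* z) (fromℕ-+ 1 n) (fromℕ-+ (f zero) _)) ⟨
  fromℕ (∑ℕ (λ i → f i * f i)) ℚ.+ (fromℕ (suc n) ℚ.* (c ℚ.* c) ℚ.- (c ℚ.+ c) ℚ.* fromℕ (∑ℕ f)) ∎
  where
  open ≡-Reasoning
  x = fromℕ (f zero)
  s = fromℕ (∑ℕ (λ i → f (suc i) * f (suc i)))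
  t = fromℕ (∑ℕ (f ∘ suc))
  ∑f²≡ : fromℕ (∑ℕ (λ i → f i * f i)) ≡ x ℚ.* x ℚ.+ s
  ∑f²≡ = trans (fromℕ-+ (f zero * f zero) _) (cong (ℚ._+ s) (fromℕ-* (f zero) (f zero)))
  rearrange : ∀ x c s n t →
    (x ℚ.- c) ℚ.* (x ℚ.- c) ℚ.+ (s ℚ.+ (n ℚ.* (c ℚ.* c) ℚ.- (c ℚ.+ c) ℚ.* t)) ≡
    (x ℚ.* x ℚ.+ s) ℚ.+ ((ℚ.1ℚ ℚ.+ n) ℚ.* (c ℚ.* c) ℚ.- (c ℚ.+ c) ℚ.* (x ℚ.+ t))
  rearrange = solve 5 (λ x c s n t →
    (x :- c) :* (x :- c) :+ (s :+ (n :* (c :* c) :- (c :+ c) :* t)) :=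
    (x :* x :+ s) :+ ((con ℚ.1ℚ :+ n) :* (c :* c) :- (c :+ c) :* (x :+ t))) refl
    where open ℚ.+-*-Solver

∑-deviation²-mono-≤ : ∀ {n} {f g : Fin n → ℕ} c → ∑ℕ f ≡ ∑ℕ g →
  ∑ℕ (λ i → f i * f i) ≤ℕ ∑ℕ (λ i → g i * g i) →
  ∑ℚ (λ i → (fromℕ (f i) ℚ.- c) ℚ.* (fromℕ (f i) ℚ.- c)) ≤
  ∑ℚ (λ i → (fromℕ (g i) ℚ.- c) ℚ.* (fromℕ (g i) ℚ.- c))
∑-deviation²-mono-≤ {n} {f} {g} c ∑f≡∑g ∑f²≤∑g² =
  subst₂ _≤_ (sym (∑-deviation² f c))
      (trans (cong (λ t → s ℚ.+ (fromℕ n ℚ.* (c ℚ.* c) ℚ.- (c ℚ.+ c) ℚ.* fromℕ t)) ∑f≡∑g) (sym (∑-deviation² g c)))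
      (ℚ.+-monoˡ-≤ _ (fromℕ-mono-≤ ∑f²≤∑g²))
  where s = fromℕ (∑ℕ (λ i → g i * g i))

-- Indicators and counting

𝟙 : {P : Set} → Dec P → ℕ
𝟙 (yes _) = 1
𝟙 (no _)  = 0

𝟙-yes : {P : Set} (d : Dec P) → P → 𝟙 d ≡ 1
𝟙-yes (yes _) p = refl
𝟙-yes (no ¬p) p = contradiction p ¬p

𝟙-no : {P : Set} (d : Dec P) → ¬ P → 𝟙 d ≡ 0
𝟙-no (yes p) ¬p = contradiction p ¬p
𝟙-no (no _)  ¬p = refl

-- Since `allFin` is `tabulate id`, taking `f = id` turns the counts in `Ω` into sums; taking `f` to
-- be a lookup counts the letters of a word.
length-filter-tabulate : {S : Set} {P : Pred S 0ℓ} (P? : Decidable P) →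
  ∀ {n} (f : Fin n → S) → length (filter P? (tabulate f)) ≡ ∑ℕ (λ i → 𝟙 (P? (f i)))
length-filter-tabulate P? {zero}  f = refl
length-filter-tabulate P? {suc n} f with P? (f zero)
... | yes _ = cong suc (length-filter-tabulate P? (f ∘ suc))
... | no  _ = length-filter-tabulate P? (f ∘ suc)

-- The chord inequality

-- The difference of the two sides is `(x - q)(x - q - 1)`, a product of consecutive integers. With
-- `q = x + t` or `x = 1 + q + t` it becomes `t * t + t`, which avoids subtraction.
chord-≤ : ∀ q x → (1 + 2 * q) * x ≤ℕ x * x + q * suc q
chord-≤ q x with ℕ.≤-<-connex x q
... | inj₁ x≤q with t , refl ← ℕ.m≤n⇒∃[o]m+o≡n x≤q = ℕ.m+n≤o⇒m≤o _ (ℕ.≤-reflexive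
  (solve 2 (λ x t → (con 1 :+ con 2 :* (x :+ t)) :* x :+ (t :* t :+ t) :=
                    x :* x :+ (x :+ t) :* (con 1 :+ (x :+ t))) refl x t))
  where open ℕ.+-*-Solver
... | inj₂ q<x with t , refl ← ℕ.m≤n⇒∃[o]m+o≡n q<x = ℕ.m+n≤o⇒m≤o _ (ℕ.≤-reflexive
  (solve 2 (λ q t → (con 1 :+ con 2 :* q) :* (con 1 :+ q :+ t) :+ (t :* t :+ t) :=
                    (con 1 :+ q :+ t) :* (con 1 :+ q :+ t) :+ q :* (con 1 :+ q)) refl q t))
  where open ℕ.+-*-Solver

chord-≡ : ∀ q {x} → x ≡ q ⊎ x ≡ suc q → (1 + 2 * q) * x ≡ x * x + q * suc q
chord-≡ q (inj₁ refl) =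
  solve 1 (λ q → (con 1 :+ con 2 :* q) :* q := q :* q :+ q :* (con 1 :+ q)) refl q
  where open ℕ.+-*-Solver
chord-≡ q (inj₂ refl) =
  solve 1 (λ q → (con 1 :+ con 2 :* q) :* (con 1 :+ q) :=
                 (con 1 :+ q) :* (con 1 :+ q) :+ q :* (con 1 :+ q)) refl q
  where open ℕ.+-*-Solver

-- Weighting by an indicator lets the sum run over all positions while only the instances of one
-- symbol contribute; the constant `q * suc q` is then counted once per instance.
𝟙-chord-≤ : {P : Set} (d : Dec P) → ∀ q x →
  (1 + 2 * q) * (𝟙 d * x) ≤ℕ 𝟙 d * (x * x) + q * suc q * 𝟙 d
𝟙-chord-≤ (yes _) q x
  rewrite ℕ.+-identityʳ x | ℕ.+-identityʳ (x * x) | ℕ.*-identityʳ (q * suc q) = chord-≤ q x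
𝟙-chord-≤ (no _)  q x =
  ℕ.≤-reflexive (trans (ℕ.*-zeroʳ (1 + 2 * q)) (sym (ℕ.*-zeroʳ (q * suc q))))

𝟙-chord-≡ : {P : Set} (d : Dec P) → ∀ q {x} → (P → x ≡ q ⊎ x ≡ suc q) →
  (1 + 2 * q) * (𝟙 d * x) ≡ 𝟙 d * (x * x) + q * suc q * 𝟙 d
𝟙-chord-≡ (yes p) q {x} near
  rewrite ℕ.+-identityʳ x | ℕ.+-identityʳ (x * x) | ℕ.*-identityʳ (q * suc q) = chord-≡ q (near p)
𝟙-chord-≡ (no _)  q near = trans (ℕ.*-zeroʳ (1 + 2 * q)) (sym (ℕ.*-zeroʳ (q * suc q)))

-- Cyclic positions

module _ {N : ℕ} .{{_ : NonZero N}} where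

  toℕ-⊕ : (j : Fin N) (d : ℕ) → toℕ (j ⊕ d) ≡ (toℕ j + d) % N
  toℕ-⊕ j d = toℕ-fromℕ< (m%n<n (toℕ j + d) N)

  ⊕-identityʳ : (j : Fin N) → j ⊕ 0 ≡ j
  ⊕-identityʳ j = toℕ-injective (begin
    toℕ (j ⊕ 0)      ≡⟨ toℕ-⊕ j 0 ⟩
    (toℕ j + 0) % N  ≡⟨ cong (_% N) (ℕ.+-identityʳ (toℕ j)) ⟩
    toℕ j % N        ≡⟨ m<n⇒m%n≡m (toℕ<n j) ⟩
    toℕ j            ∎)
    where open ≡-Reasoning

  ⊕-assoc : (j : Fin N) (d e : ℕ) → j ⊕ d ⊕ e ≡ j ⊕ (d + e)
  ⊕-assoc j d e = toℕ-injective (begin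
    toℕ (j ⊕ d ⊕ e)                    ≡⟨ toℕ-⊕ (j ⊕ d) e ⟩
    (toℕ (j ⊕ d) + e) % N              ≡⟨ cong (λ x → (x + e) % N) (toℕ-⊕ j d) ⟩
    ((toℕ j + d) % N + e) % N          ≡⟨ %-distribˡ-+ ((toℕ j + d) % N) e N ⟩
    ((toℕ j + d) % N % N + e % N) % N  ≡⟨ cong (λ x → (x + e % N) % N) (m%n%n≡m%n (toℕ j + d) N) ⟩
    ((toℕ j + d) % N + e % N) % N      ≡⟨ %-distribˡ-+ (toℕ j + d) e N ⟨
    (toℕ j + d + e) % N                ≡⟨ cong (_% N) (ℕ.+-assoc (toℕ j) d e) ⟩
    (toℕ j + (d + e)) % N              ≡⟨ toℕ-⊕ j (d + e) ⟨
    toℕ (j ⊕ (d + e))                  ∎)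
    where open ≡-Reasoning

  ⊕-transitive : (i j : Fin N) → ∃ λ d → i ⊕ d ≡ j
  ⊕-transitive i j = d , toℕ-injective (begin
    toℕ (i ⊕ d)      ≡⟨ toℕ-⊕ i d ⟩
    (toℕ i + d) % N  ≡⟨ cong (_% N) i+d≡j+N ⟩
    (toℕ j + N) % N  ≡⟨ [m+n]%n≡m%n (toℕ j) N ⟩
    toℕ j % N        ≡⟨ m<n⇒m%n≡m (toℕ<n j) ⟩
    toℕ j            ∎)
    where
    open ≡-Reasoning
    -- One full turn is added before going back `toℕ i` steps, so that truncated subtraction is
    -- exact.
    d = toℕ j + (N ∸ toℕ i)
    i+d≡j+N : toℕ i + d ≡ toℕ j + N
    i+d≡j+N = begin
      toℕ i + (toℕ j + (N ∸ toℕ i))  ≡⟨ solve 3 (λ x y z → x :+ (y :+ z) := y :+ (x :+ z)) refl (toℕ i) (toℕ j) (N ∸ toℕ i) ⟩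
      toℕ j + (toℕ i + (N ∸ toℕ i))  ≡⟨ cong (toℕ j +_) (ℕ.m+[n∸m]≡n (ℕ.<⇒≤ (toℕ<n i))) ⟩
      toℕ j + N                      ∎
      where open ℕ.+-*-Solver

  -- The shift by one is a permutation, with the shift by `N - 1` as its inverse.
  ∑-⊕1 : (f : Fin N → ℕ) → ∑ℕ (λ j → f (j ⊕ 1)) ≡ ∑ℕ f
  ∑-⊕1 f = sym (sum-permute f
    (permutation (_⊕ 1) (_⊕ pred N)
      (λ j → trans (⊕-assoc j (pred N) 1) (trans (cong (j ⊕_) (trans (ℕ.+-comm _ 1) 1+[N-1])) (⊕-period j)))
      (λ j → trans (⊕-assoc j 1 (pred N)) (trans (cong (j ⊕_) 1+[N-1]) (⊕-period j)))))
    where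
    1+[N-1] : suc (pred N) ≡ N
    1+[N-1] = ℕ.suc-pred N

-- Least witnesses and countdowns to the next instance

Least : Pred ℕ 0ℓ → Pred ℕ 0ℓ
Least P d = P d × (∀ {e} → e < d → ¬ P e)

Least-unique : {P : Pred ℕ 0ℓ} {d d′ : ℕ} → Least P d → Least P d′ → d ≡ d′
Least-unique {d = d} {d′} (p , min) (p′ , min′) with ℕ.<-cmp d d′
... | tri< d<d′ _ _ = contradiction p (min′ d<d′)
... | tri≈ _ eq _   = eq
... | tri> _ _ d>d′ = contradiction p′ (min d>d′)

-- `Q` is `P` shifted by one. Two implications are asked for because `p ⊕ 1 ⊕ e` and `p ⊕ suc e`
-- agree only propositionally, and because `P` may also contain the condition `1 ≤ e`.
Least-suc : {P Q : Pred ℕ 0ℓ} {d : ℕ} → ¬ P 0 →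
  (∀ {e} → Q e → P (suc e)) → (∀ {e} → P (suc e) → Q e) → Least Q d → Least P (suc d)
Least-suc {P} {d = d} ¬p0 Q⇒P P⇒Q (q , min) = Q⇒P q , below
  where
  below : ∀ {e} → e < suc d → ¬ P e
  below {zero}  _         = ¬p0
  below {suc e} (s≤s e<d) = min e<d ∘ P⇒Q

module _ {n} .{{_ : NonZero n}} (𝒫 : CyclicSequencingProblem n) where
  open CyclicSequencingProblem 𝒫

  -- g p is the number of steps from p to the first instance of s at or after p.
  record Countdown (C : Cycle) (s : Symbol) (g : Fin N → ℕ) : Set where
    field
      hit  : ∀ {p} → C p ≡ s → g p ≡ 0
      miss : ∀ {p} → C p ≢ s → g p ≡ suc (g (p ⊕ 1))

  open Countdown

  least-from-next : (C : Cycle) (p : Fin N) → ∀ {s d} → C p ≢ s →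
    Least (λ e → C (p ⊕ 1 ⊕ e) ≡ s) d → Least (λ e → C (p ⊕ e) ≡ s) (suc d)
  least-from-next C p Cp≢s = Least-suc
    (Cp≢s ∘ trans (cong C (sym (⊕-identityʳ p))))
    (trans (cong C (sym (⊕-assoc p 1 _))))
    (trans (cong C (⊕-assoc p 1 _)))

  -- Positions on a cycle carry no well-founded order, so the induction is on the value of `g p`,
  -- which drops by one at every miss.
  countdown-least : ∀ {C s g} → Countdown C s g → ∀ p → Least (λ e → C (p ⊕ e) ≡ s) (g p)
  countdown-least {C} {s} {g} cd p = go (g p) p refl
    where
    go : ∀ t p → g p ≡ t → Least (λ e → C (p ⊕ e) ≡ s) t
    go t p gp≡t with C p ≟ s
    ... | yes Cp≡s rewrite trans (sym gp≡t) (hit cd Cp≡s) = trans (cong C (⊕-identityʳ p)) Cp≡s , λ ()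
    go zero p gp≡t | no Cp≢s = contradiction (trans (sym gp≡t) (miss cd Cp≢s)) λ ()
    go (suc t) p gp≡t | no Cp≢s = least-from-next C p Cp≢s
      (go t (p ⊕ 1) (ℕ.suc-injective (trans (sym (miss cd Cp≢s)) gp≡t)))

  -- The condition `1 ≤ d` excludes the instance at `p` itself, so the search for the next one
  -- starts at `p ⊕ 1` and its result is one step short.
  countdown-Δ : ∀ {C s g} → Countdown C s g → ∀ {p} → C p ≡ s → Δ C p ≡ suc (g (p ⊕ 1))
  countdown-Δ {C} {s} {g} cd {p} Cp≡s = Least-unique (proj₂ (nextInstance C p))
    (Least-suc (λ ())
      (λ found → s≤s z≤n , trans (cong C (sym (⊕-assoc p 1 _))) (trans found (sym Cp≡s)))
      (λ (_ , again) → trans (cong C (⊕-assoc p 1 _)) (trans again Cp≡s))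
      (countdown-least cd (p ⊕ 1)))

  countdown : ∀ C {s j} → C j ≡ s → ∃ (Countdown C s)
  countdown C {s} {j} Cj≡s = g , record
    { hit  = λ {p} Cp≡s → Least-unique (g-least p) (trans (cong C (⊕-identityʳ p)) Cp≡s , λ ())
    ; miss = λ {p} Cp≢s → Least-unique (g-least p) (least-from-next C p Cp≢s (g-least (p ⊕ 1)))
    }
    where
    first : ∀ p → ∃ (Least (λ e → C (p ⊕ e) ≡ s))
    -- Some number of steps leads from `p` to the known instance `j`, which bounds the search.
    first p with d , p⊕d≡j ← ⊕-transitive p j =
      least (λ e → C (p ⊕ e) ≟ s) d (trans (cong C p⊕d≡j) Cj≡s)
    g : Fin N → ℕ
    g p = proj₁ (first p)
    g-least : ∀ p → Least (λ e → C (p ⊕ e) ≡ s) (g p)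
    g-least p = proj₂ (first p)

  -- The relation g p + [C p = s] Δ p = 1 + g (p + 1) telescopes around the cycle.
  ∑-gaps-countdown : ∀ {C s g} → Countdown C s g → ∑ℕ (λ j → 𝟙 (C j ≟ s) * Δ C j) ≡ N
  ∑-gaps-countdown {C} {s} {g} cd = ℕ.+-cancelˡ-≡ (∑ℕ g) _ _ (begin
    ∑ℕ g + ∑ℕ (λ j → 𝟙 (C j ≟ s) * Δ C j)    ≡⟨ ∑-distrib-+ g _ ⟨
    ∑ℕ (λ j → g j + 𝟙 (C j ≟ s) * Δ C j)     ≡⟨ sum-cong-≗ step ⟩
    ∑ℕ (λ j → suc (g (j ⊕ 1)))               ≡⟨ ∑-suc (λ j → g (j ⊕ 1)) ⟩
    N + ∑ℕ (λ j → g (j ⊕ 1))                 ≡⟨ cong (N +_) (∑-⊕1 g) ⟩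
    N + ∑ℕ g                                 ≡⟨ ℕ.+-comm N _ ⟩
    ∑ℕ g + N                                 ∎)
    where
    open ≡-Reasoning
    step : ∀ j → g j + 𝟙 (C j ≟ s) * Δ C j ≡ suc (g (j ⊕ 1))
    step j = cases (C j ≟ s)
      where
      cases : (d : Dec (C j ≡ s)) → g j + 𝟙 d * Δ C j ≡ suc (g (j ⊕ 1))
      cases (yes Cj≡s) = trans (cong₂ _+_ (hit cd Cj≡s) (ℕ.*-identityˡ (Δ C j))) (countdown-Δ cd Cj≡s)
      cases (no  Cj≢s) = trans (ℕ.+-identityʳ (g j)) (miss cd Cj≢s)

  -- Sums over the instances of each symbol

  ∑-instances : ∀ {C} → C ∈ Ω → ∀ k → ∑ℕ (λ j → 𝟙 (C j ≟ a k)) ≡ m k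
  ∑-instances {C} C∈Ω k = trans (sym (length-filter-tabulate (λ j → C j ≟ a k) id)) (C∈Ω k)

  occurs : ∀ {C} → C ∈ Ω → ∀ k → ∃ λ j → C j ≡ a k
  occurs {C} C∈Ω k with any? (λ j → C j ≟ a k)
  ... | yes found = found
  ... | no  none  = contradiction
    (trans (sym (C∈Ω k)) (cong length (filter-none (λ j → C j ≟ a k) (universal (λ j eq → none (j , eq)) (allFin N)))))
    (≢-nonZero⁻¹ (m k) {{m-pos k}})

  ∑-gaps : ∀ {C} → C ∈ Ω → ∀ k → ∑ℕ (λ j → 𝟙 (C j ≟ a k) * Δ C j) ≡ N
  ∑-gaps {C} C∈Ω k with _ , Cj≡ak ← occurs C∈Ω k = ∑-gaps-countdown (proj₂ (countdown C Cj≡ak))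

  -- At each position exactly one symbol has indicator 1; the two summations are then exchanged.
  ∑-by-symbol : (C : Cycle) (f : Fin N → ℕ) → ∑ℕ f ≡ ∑ℕ (λ k → ∑ℕ (λ j → 𝟙 (C j ≟ a k) * f j))
  ∑-by-symbol C f = trans (sum-cong-≗ split) (∑-comm (λ j k → 𝟙 (C j ≟ a k) * f j))
    where
    split : ∀ j → f j ≡ ∑ℕ (λ k → 𝟙 (C j ≟ a k) * f j)
    split j = sym (trans (∑-single _ i vanish) single)
      where
      i = Inverse.from alphabet (C j)
      ai≡Cj : a i ≡ C j
      ai≡Cj = Inverse.strictlyInverseˡ alphabet (C j)
      vanish : ∀ k → k ≢ i → 𝟙 (C j ≟ a k) * f j ≡ 0
      vanish k k≢i = cong (_* f j) (𝟙-no (C j ≟ a k) λ Cj≡ak → k≢i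
        (trans (sym (Inverse.strictlyInverseʳ alphabet k)) (cong (Inverse.from alphabet) (sym Cj≡ak))))
      single : 𝟙 (C j ≟ a i) * f j ≡ f j
      single = trans (cong (_* f j) (𝟙-yes (C j ≟ a i) (sym ai≡Cj))) (ℕ.*-identityˡ (f j))

  -- Optimality of balanced cycles

  Balanced : Cycle → Symbol → Set
  Balanced C s = ∃ λ q → ∀ j → C j ≡ s → Δ C j ≡ q ⊎ Δ C j ≡ suc q

  module _ {C} (C∈Ω : C ∈ Ω) (k : Fin n) (q : ℕ) where

    private
      lower upper : Fin N → ℕ
      lower j = (1 + 2 * q) * (𝟙 (C j ≟ a k) * Δ C j)
      upper j = 𝟙 (C j ≟ a k) * (Δ C j * Δ C j) + q * suc q * 𝟙 (C j ≟ a k)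

      ∑-lower : ∑ℕ lower ≡ (1 + 2 * q) * N
      ∑-lower = trans (sym (*-distribˡ-sum (1 + 2 * q) (λ j → 𝟙 (C j ≟ a k) * Δ C j)))
                      (cong ((1 + 2 * q) *_) (∑-gaps C∈Ω k))

      ∑-upper : ∑ℕ upper ≡ ∑ℕ (λ j → 𝟙 (C j ≟ a k) * (Δ C j * Δ C j)) + q * suc q * m k
      ∑-upper = trans (∑-distrib-+ (λ j → 𝟙 (C j ≟ a k) * (Δ C j * Δ C j)) _)
        (cong (∑ℕ (λ j → 𝟙 (C j ≟ a k) * (Δ C j * Δ C j)) +_)
          (trans (sym (*-distribˡ-sum (q * suc q) (λ j → 𝟙 (C j ≟ a k))))
                 (cong (q * suc q *_) (∑-instances C∈Ω k))))

    -- The gaps of a symbol add up to `N` and there are `m k` of them. In the summed chord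
    -- inequality, everything but the sum of squares is thus the same for all admissible cycles.
    ∑-gaps²-≥ : (1 + 2 * q) * N ≤ℕ ∑ℕ (λ j → 𝟙 (C j ≟ a k) * (Δ C j * Δ C j)) + q * suc q * m k
    ∑-gaps²-≥ = subst₂ _≤ℕ_ ∑-lower ∑-upper (∑-mono-≤ pointwise)
      where
      pointwise : ∀ j → lower j ≤ℕ upper j
      pointwise j = 𝟙-chord-≤ (C j ≟ a k) q (Δ C j)

    ∑-gaps²-balanced : (∀ j → C j ≡ a k → Δ C j ≡ q ⊎ Δ C j ≡ suc q) →
      (1 + 2 * q) * N ≡ ∑ℕ (λ j → 𝟙 (C j ≟ a k) * (Δ C j * Δ C j)) + q * suc q * m k
    ∑-gaps²-balanced balanced = trans (sym ∑-lower) (trans (sum-cong-≗ pointwise) ∑-upper)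
      where
      pointwise : ∀ j → lower j ≡ upper j
      pointwise j = 𝟙-chord-≡ (C j ≟ a k) q (balanced j)

  ∑Δ-constant : ∀ {C C′} → C ∈ Ω → C′ ∈ Ω → ∑ℕ (Δ C) ≡ ∑ℕ (Δ C′)
  ∑Δ-constant {C} {C′} C∈Ω C′∈Ω = begin
    ∑ℕ (Δ C)                                       ≡⟨ ∑-by-symbol C (Δ C) ⟩
    ∑ℕ (λ k → ∑ℕ (λ j → 𝟙 (C j ≟ a k) * Δ C j))    ≡⟨ sum-cong-≗ (λ k → trans (∑-gaps C∈Ω k) (sym (∑-gaps C′∈Ω k))) ⟩
    ∑ℕ (λ k → ∑ℕ (λ j → 𝟙 (C′ j ≟ a k) * Δ C′ j))  ≡⟨ ∑-by-symbol C′ (Δ C′) ⟨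
    ∑ℕ (Δ C′)                                      ∎
    where open ≡-Reasoning

  balanced⇒∑Δ²-minimal : ∀ {C C′} → C ∈ Ω → (∀ k → Balanced C (a k)) → C′ ∈ Ω →
    ∑ℕ (λ j → Δ C j * Δ C j) ≤ℕ ∑ℕ (λ j → Δ C′ j * Δ C′ j)
  balanced⇒∑Δ²-minimal {C} {C′} C∈Ω balanced C′∈Ω =
    subst₂ _≤ℕ_ (sym (∑-by-symbol C _)) (sym (∑-by-symbol C′ _)) (∑-mono-≤ per-symbol)
    where
    per-symbol : ∀ k → ∑ℕ (λ j → 𝟙 (C j ≟ a k) * (Δ C j * Δ C j)) ≤ℕ ∑ℕ (λ j → 𝟙 (C′ j ≟ a k) * (Δ C′ j * Δ C′ j))
    -- The `q` of the balanced cycle serves for both: it gives equality for `C` and a lower bound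
    -- for `C′`.
    per-symbol k with q , gaps ← balanced k =
      ℕ.+-cancelʳ-≤ (q * suc q * m k) _ _
        (ℕ.≤-trans (ℕ.≤-reflexive (sym (∑-gaps²-balanced C∈Ω k q gaps))) (∑-gaps²-≥ C′∈Ω k q))

  balanced⇒σ²-minimal : ∀ {C C′} → C ∈ Ω → (∀ k → Balanced C (a k)) → C′ ∈ Ω → σ² C ≤ σ² C′
  balanced⇒σ²-minimal {C} {C′} C∈Ω balanced C′∈Ω =
    ℚ.*-monoˡ-≤-nonNeg (ℤ.+ 1 ℚ./ N) {{ℚ.normalize-nonNeg 1 N}}
      -- The means agree, so both sums of squared deviations can be taken about the same centre
      -- `μ C`.
      (subst (λ μ′ → ∑ℚ (λ j → (Δℚ C j ℚ.- μ C) ℚ.* (Δℚ C j ℚ.- μ C)) ≤ ∑ℚ (λ j → (Δℚ C′ j ℚ.- μ′) ℚ.* (Δℚ C′ j ℚ.- μ′)))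
        μ≡μ′
        (∑-deviation²-mono-≤ {f = Δ C} {Δ C′} (μ C) (∑Δ-constant C∈Ω C′∈Ω) (balanced⇒∑Δ²-minimal C∈Ω balanced C′∈Ω)))
    where
    μ≡μ′ : μ C ≡ μ C′
    μ≡μ′ = cong ((ℤ.+ 1 ℚ./ N) ℚ.*_) (begin
      ∑ℚ (Δℚ C)          ≡⟨ ∑-fromℕ (Δ C) ⟩
      fromℕ (∑ℕ (Δ C))   ≡⟨ cong fromℕ (∑Δ-constant C∈Ω C′∈Ω) ⟩
      fromℕ (∑ℕ (Δ C′))  ≡⟨ ∑-fromℕ (Δ C′) ⟨
      ∑ℚ (Δℚ C′)         ∎)
      where open ≡-Reasoning

-- Words built by the rounds

-- A Euclidean step preserves `P * h A + D * h B`: with `P = R + Q * D` the new value is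
-- `D * (Q * h A + h B) + R * h A`. Letter counts are additive in this sense, which yields
-- admissibility.
rounds-additive : {S : Set} (h : List S → ℕ) → h [] ≡ 0 → (∀ xs ys → h (xs ++ ys) ≡ h xs + h ys) →
  ∀ A B P D .{{_ : NonZero D}} (ac : Acc _<_ D) → h (rounds A B P D ac) ≡ P * h A + D * h B
rounds-additive {S} h h-[] h-++ = go
  where
  h-^ : ∀ W q → h (W ^ q) ≡ q * h W
  h-^ W zero    = h-[]
  h-^ W (suc q) = trans (h-++ W (W ^ q)) (cong (h W +_) (h-^ W q))

  h-block : ∀ A B Q → h (A ^ Q ++ B) ≡ Q * h A + h B
  h-block A B Q = trans (h-++ (A ^ Q) B) (cong (_+ h B) (h-^ A Q))

  go : ∀ A B P D .{{_ : NonZero D}} (ac : Acc _<_ D) → h (rounds A B P D ac) ≡ P * h A + D * h B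
  go A B P D (acc rs) with P % D | m%n<n P D | m≡m%n+[m/n]*n P D
  ... | zero | _ | P≡ = begin
    h ((A ^ Q ++ B) ^ D)       ≡⟨ h-^ (A ^ Q ++ B) D ⟩
    D * h (A ^ Q ++ B)         ≡⟨ cong (D *_) (h-block A B Q) ⟩
    D * (Q * h A + h B)        ≡⟨ solve 4 (λ d q x y → d :* (q :* x :+ y) := (q :* d) :* x :+ d :* y)
                                    refl D Q (h A) (h B) ⟩
    Q * D * h A + D * h B      ≡⟨ cong (λ p → p * h A + D * h B) P≡ ⟨
    P * h A + D * h B          ∎
    where
    open ≡-Reasoning
    open ℕ.+-*-Solver
    Q = P / D
  ... | suc R | R<D | P≡ = begin
    h (rounds (A ^ Q ++ B) A D (suc R) (rs R<D))  ≡⟨ go (A ^ Q ++ B) A D (suc R) (rs R<D) ⟩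
    D * h (A ^ Q ++ B) + suc R * h A              ≡⟨ cong (λ l → D * l + suc R * h A) (h-block A B Q) ⟩
    D * (Q * h A + h B) + suc R * h A             ≡⟨ solve 5 (λ d q x y r → d :* (q :* x :+ y) :+ r :* x := (r :+ q :* d) :* x :+ d :* y)
                                                       refl D Q (h A) (h B) (suc R) ⟩
    (suc R + Q * D) * h A + D * h B               ≡⟨ cong (λ p → p * h A + D * h B) P≡ ⟨
    P * h A + D * h B                             ∎
    where
    open ≡-Reasoning
    open ℕ.+-*-Solver
    Q = P / D

module _ {S : Set} (L : List S → Set) (L-[] : L []) (L-++ : ∀ {xs ys} → L xs → L ys → L (xs ++ ys)) where

  ^-closed : ∀ {W} q → L W → L (W ^ q)
  ^-closed zero    l = L-[]
  ^-closed (suc q) l = L-++ l (^-closed q l)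

  rounds-closed : ∀ {A B} P D .{{_ : NonZero D}} (ac : Acc _<_ D) → L A → L B → L (rounds A B P D ac)
  rounds-closed P D (acc rs) lA lB with P % D | m%n<n P D
  ... | zero  | _   = ^-closed D (L-++ (^-closed (P / D) lA) lB)
  ... | suc R | R<D = rounds-closed D (suc R) (rs R<D) (L-++ (^-closed (P / D) lA) lB) lA

  -- When D ≤ P the first round uses B only in A^Q B with Q ≥ 1, so B itself need not be in L.
  rounds-closed-≥ : ∀ {A B} P D .{{_ : NonZero D}} (ac : Acc _<_ D) → D ≤ℕ P →
                    L A → (∀ q → L (A ^ suc q ++ B)) → L (rounds A B P D ac)
  rounds-closed-≥ {A} {B} P D (acc rs) D≤P lA lAB
    with P % D | m%n<n P D | ℕ.suc-pred (P / D) {{>-nonZero (m≥n⇒m/n>0 D≤P)}}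
  ... | zero  | _   | P/D≡ = ^-closed D (subst (λ q → L (A ^ q ++ B)) P/D≡ (lAB (pred (P / D))))
  ... | suc R | R<D | P/D≡ =
    rounds-closed D (suc R) (rs R<D) (subst (λ q → L (A ^ q ++ B)) P/D≡ (lAB (pred (P / D)))) lA

-- Run b q t w u: reading w, the number of letters still to be skipped before
-- the next b is t at the start and u at the end, and is q or q + 1 just after each b.
data Run {S : Set} (b : S) (q : ℕ) : ℕ → List S → ℕ → Set where
  []   : ∀ {t} → Run b q t [] t
  hit  : ∀ {t w u} → t ≡ q ⊎ t ≡ suc q → Run b q t w u → Run b q 0 (b ∷ w) u
  miss : ∀ {x t w u} → x ≢ b → Run b q t w u → Run b q (suc t) (x ∷ w) u

module _ {S : Set} {b : S} {q : ℕ} where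

  infixr 5 _+++_

  _+++_ : ∀ {t v w t′ u} → Run b q t v u → Run b q u w t′ → Run b q t (v ++ w) t′
  []       +++ s = s
  hit e r  +++ s = hit e (r +++ s)
  miss n r +++ s = miss n (r +++ s)

  remaining : ∀ {t w u} → Run b q t w u → ℕ → ℕ
  remaining {t} r          zero    = t
  -- By convention the final state persists beyond the end of the word.
  remaining {t} []         (suc i) = t
  remaining     (hit _ r)  (suc i) = remaining r i
  remaining     (miss _ r) (suc i) = remaining r i

  remaining-length : ∀ {t w u} (r : Run b q t w u) → remaining r (length w) ≡ u
  remaining-length []         = refl
  remaining-length (hit _ r)  = remaining-length r
  remaining-length (miss _ r) = remaining-length r

  remaining-hit : ∀ {t w u} (r : Run b q t w u) i → lookup w i ≡ b → remaining r (toℕ i) ≡ 0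
  remaining-hit (hit _ r)    zero    eq = refl
  remaining-hit (miss x≢b r) zero    eq = contradiction eq x≢b
  remaining-hit (hit _ r)    (suc i) eq = remaining-hit r i eq
  remaining-hit (miss _ r)   (suc i) eq = remaining-hit r i eq

  remaining-after-hit : ∀ {t w u} (r : Run b q t w u) i → lookup w i ≡ b →
    remaining r (suc (toℕ i)) ≡ q ⊎ remaining r (suc (toℕ i)) ≡ suc q
  remaining-after-hit (hit e r)    zero    eq = e
  remaining-after-hit (miss x≢b r) zero    eq = contradiction eq x≢b
  remaining-after-hit (hit _ r)    (suc i) eq = remaining-after-hit r i eq
  remaining-after-hit (miss _ r)   (suc i) eq = remaining-after-hit r i eq

  remaining-miss : ∀ {t w u} (r : Run b q t w u) i → lookup w i ≢ b →
    remaining r (toℕ i) ≡ suc (remaining r (suc (toℕ i)))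
  remaining-miss (hit _ r)  zero    ne = contradiction refl ne
  remaining-miss (miss _ r) zero    ne = refl
  remaining-miss (hit _ r)  (suc i) ne = remaining-miss r i ne
  remaining-miss (miss _ r) (suc i) ne = remaining-miss r i ne

  -- X may be followed by X or Y, and Y only by X, so Y never follows itself.
  block-run : ∀ {X Y} → Run b q q X q → Run b q q X (suc q) → Run b q (suc q) Y q →
              ∀ p → Run b q q (X ^ suc p ++ Y) q
  block-run {X} X→X X→Y Y→X p = powers p +++ Y→X
    where
    powers : ∀ p → Run b q q (X ^ suc p) (suc q)
    powers zero    = X→Y +++ []
    powers (suc p) = X→X +++ powers p

  -- `X` and every block `X ^ suc p ++ Y` lead from state `q` back to `q`, so they can be
  -- concatenated freely. `X` needs two runs because the wait after its last `b` depends on whether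
  -- `X` or `Y` follows.
  rounds-run : ∀ {X Y} P D .{{_ : NonZero D}} (ac : Acc _<_ D) → D ≤ℕ P →
               Run b q q X q → Run b q q X (suc q) → Run b q (suc q) Y q →
               Run b q q (rounds X Y P D ac) q
  rounds-run P D ac D≤P X→X X→Y Y→X =
    rounds-closed-≥ (λ w → Run b q q w q) [] _+++_ P D ac D≤P X→X (block-run X→X X→Y Y→X)

module _ {S : Set} {x y : S} (x≢y : x ≢ y) where

  -- Here `q = 0`: after an `x`, the next `x` comes at once or after a single `y`.
  rounds-run-leading : ∀ P D .{{_ : NonZero D}} (ac : Acc _<_ D) → D ≤ℕ P →
                       Run x 0 0 (rounds [ x ] [ y ] P D ac) 0
  rounds-run-leading P D ac D≤P =
    rounds-run P D ac D≤P (hit (inj₁ refl) []) (hit (inj₂ refl) []) (miss (x≢y ∘ sym) [])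

  first-block-run : ∀ q {t} → t ≡ q ⊎ t ≡ suc q → Run y q q ([ x ] ^ q ++ [ y ]) t
  first-block-run q {t} t≈q = go q
    where
    go : ∀ p → Run y q p ([ x ] ^ p ++ [ y ]) t
    go zero    = hit t≈q []
    go (suc p) = miss x≢y (go p)

  -- After the first round the blocks are `x^Q y` and `x`, with `Q = P / D`. A lone `x` between two
  -- long blocks raises the wait for the next `y` from `Q` to `Q + 1`.
  rounds-run-other : ∀ P D .{{_ : NonZero D}} (ac : Acc _<_ D) →
                     Run y (P / D) (P / D) (rounds [ x ] [ y ] P D ac) (P / D)
  rounds-run-other P D (acc rs) with P % D | m%n<n P D
  ... | zero  | _   = ^-closed (λ w → Run y (P / D) (P / D) w (P / D)) [] _+++_ D
                        (first-block-run (P / D) (inj₁ refl))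
  -- From the second round on, `D` and `R` take the places of `P` and `D`, and `R < D` supplies the
  -- size condition.
  ... | suc R | R<D = rounds-run D (suc R) (rs R<D) (ℕ.<⇒≤ R<D)
                        (first-block-run (P / D) (inj₁ refl)) (first-block-run (P / D) (inj₂ refl)) (miss x≢y [])

-- From words to cycles

tabulate-lookup-cast : ∀ {S : Set} {n} (w : List S) (eq : n ≡ length w) →
                       tabulate (λ j → lookup w (cast eq j)) ≡ w
tabulate-lookup-cast w refl =
  trans (tabulate-cong (λ j → cong (lookup w) (cast-is-id refl j))) (tabulate-lookup w)

module _ {n} .{{_ : NonZero n}} (𝒫 : CyclicSequencingProblem n) where
  open CyclicSequencingProblem 𝒫

  -- A run that ends in its initial state closes up around the cycle, so its states form a
  -- countdown.
  run⇒balanced : ∀ {s q} w (r : Run s q q w q) (eq : N ≡ length w) →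
                 Balanced 𝒫 (λ j → lookup w (cast eq j)) s
  -- A gap is one more than the number of letters skipped, hence `suc q`.
  run⇒balanced {s} {q} w r eq = suc q , gaps
    where
    C : Cycle
    C j = lookup w (cast eq j)
    g : Fin N → ℕ
    g j = remaining r (toℕ j)

    g-next : ∀ j → g (j ⊕ 1) ≡ remaining r (suc (toℕ j))
    g-next j = trans (cong (remaining r) (trans (toℕ-⊕ j 1) (cong (_% N) (ℕ.+-comm (toℕ j) 1))))
                     (wrap (ℕ.m≤n⇒m<n∨m≡n (toℕ<n j)))
      where
      wrap : suc (toℕ j) < N ⊎ suc (toℕ j) ≡ N → remaining r (suc (toℕ j) % N) ≡ remaining r (suc (toℕ j))
      wrap (inj₁ <N) = cong (remaining r) (m<n⇒m%n≡m <N)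
      -- Past the last letter the position returns to the start, where the state is again `q`.
      wrap (inj₂ ≡N) = begin
        remaining r (suc (toℕ j) % N)  ≡⟨ cong (λ i → remaining r (i % N)) ≡N ⟩
        remaining r (N % N)            ≡⟨ cong (remaining r) (n%n≡0 N) ⟩
        q                              ≡⟨ remaining-length r ⟨
        remaining r (length w)         ≡⟨ cong (remaining r) (trans ≡N eq) ⟨
        remaining r (suc (toℕ j))      ∎
        where open ≡-Reasoning

    at-cast : ∀ j → toℕ (cast eq j) ≡ toℕ j
    at-cast j = toℕ-cast eq j

    g-countdown : Countdown 𝒫 C s g
    g-countdown = record
      { hit  = λ {p} Cp≡s → trans (cong (remaining r) (sym (at-cast p))) (remaining-hit r (cast eq p) Cp≡s)
      ; miss = λ {p} Cp≢s → begin
          remaining r (toℕ p)                     ≡⟨ cong (remaining r) (at-cast p) ⟨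
          remaining r (toℕ (cast eq p))           ≡⟨ remaining-miss r (cast eq p) Cp≢s ⟩
          suc (remaining r (suc (toℕ (cast eq p)))) ≡⟨ cong (λ i → suc (remaining r (suc i))) (at-cast p) ⟩
          suc (remaining r (suc (toℕ p)))         ≡⟨ cong suc (g-next p) ⟨
          suc (g (p ⊕ 1))                         ∎
      }
      where open ≡-Reasoning

    gaps : ∀ j → C j ≡ s → Δ C j ≡ suc q ⊎ Δ C j ≡ suc (suc q)
    gaps j Cj≡s = Sum.map (trans Δ≡ ∘ cong suc) (trans Δ≡ ∘ cong suc) (remaining-after-hit r (cast eq j) Cj≡s)
      where
      Δ≡ : Δ C j ≡ suc (remaining r (suc (toℕ (cast eq j))))
      Δ≡ = trans (countdown-Δ 𝒫 g-countdown Cj≡s)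
                 (cong suc (trans (g-next j) (cong (λ i → remaining r (suc i)) (sym (at-cast j)))))

  count : Symbol → List Symbol → ℕ
  count s w = length (filter (_≟ s) w)

  count-++ : ∀ s v w → count s (v ++ w) ≡ count s v + count s w
  count-++ s v w = trans (cong length (filter-++ (_≟ s) v w)) (length-++ (filter (_≟ s) v))

  count-same : ∀ s → count s [ s ] ≡ 1
  count-same s = cong length (filter-accept (_≟ s) refl)

  count-other : ∀ {s x} → x ≢ s → count s [ x ] ≡ 0
  count-other {s} x≢s = cong length (filter-reject (_≟ s) x≢s)

  count-lookup : ∀ s w (eq : N ≡ length w) →
    length (filter (λ j → lookup w (cast eq j) ≟ s) (allFin N)) ≡ count s w
  count-lookup s w eq = begin
    length (filter (λ j → lookup w (cast eq j) ≟ s) (allFin N))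
      ≡⟨ length-filter-tabulate (λ j → lookup w (cast eq j) ≟ s) id ⟩
    ∑ℕ (λ j → 𝟙 (lookup w (cast eq j) ≟ s))
      ≡⟨ length-filter-tabulate (_≟ s) (λ j → lookup w (cast eq j)) ⟨
    count s (tabulate (λ j → lookup w (cast eq j)))
      ≡⟨ cong (count s) (tabulate-lookup-cast w eq) ⟩
    count s w ∎
    where open ≡-Reasoning

-- Admissibility and balance of the cycle returned by the algorithm

same-or-opposite : (k i : Fin 2) → i ≡ k ⊎ i ≡ opposite k
same-or-opposite zero       zero       = inj₁ refl
same-or-opposite zero       (suc zero) = inj₂ refl
same-or-opposite (suc zero) zero       = inj₂ refl
same-or-opposite (suc zero) (suc zero) = inj₁ refl

opposite-≢ : (k : Fin 2) → k ≢ opposite k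
opposite-≢ zero       ()
opposite-≢ (suc zero) ()

module _ (𝒫 : CyclicSequencingProblem 2) where
  open CyclicSequencingProblem 𝒫
  open ESA 𝒫

  a-opposite-≢ : ∀ k → a k ≢ a (opposite k)
  a-opposite-≢ k eq = opposite-≢ k (begin
    k                                       ≡⟨ Inverse.strictlyInverseʳ alphabet k ⟨
    Inverse.from alphabet (a k)             ≡⟨ cong (Inverse.from alphabet) eq ⟩
    Inverse.from alphabet (a (opposite k))  ≡⟨ Inverse.strictlyInverseʳ alphabet (opposite k) ⟩
    opposite k                              ∎)
    where open ≡-Reasoning

  count-word : ∀ k (leading : IsLeading k) s →
    count 𝒫 s (word k leading) ≡ m k * count 𝒫 s [ a k ] + m (opposite k) * count 𝒫 s [ a (opposite k) ]
  count-word k leading s = rounds-additive (count 𝒫 s) refl (count-++ 𝒫 s)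
    [ a k ] [ a (opposite k) ] (m k) (m (opposite k)) {{m-pos (opposite k)}} (<-wellFounded _)

  cycle∈Ω : ∀ k (leading : IsLeading k) → cycle k leading ∈ Ω
  cycle∈Ω k leading i =
    trans (count-lookup 𝒫 (a i) (word k leading) (sym (length-word k leading)))
      (trans (count-word k leading (a i)) (by-cases (same-or-opposite k i)))
    where
    by-cases : i ≡ k ⊎ i ≡ opposite k →
      m k * count 𝒫 (a i) [ a k ] + m (opposite k) * count 𝒫 (a i) [ a (opposite k) ] ≡ m i
    by-cases (inj₁ refl)
      rewrite count-same 𝒫 (a k) | count-other 𝒫 (a-opposite-≢ k ∘ sym)
            | ℕ.*-identityʳ (m k) | ℕ.*-zeroʳ (m (opposite k)) = ℕ.+-identityʳ (m k)
    by-cases (inj₂ refl)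
      rewrite count-same 𝒫 (a (opposite k)) | count-other 𝒫 (a-opposite-≢ k)
            | ℕ.*-zeroʳ (m k) = ℕ.*-identityʳ (m (opposite k))

  cycle-balanced : ∀ k (leading : IsLeading k) i → Balanced 𝒫 (cycle k leading) (a i)
  cycle-balanced k leading i with same-or-opposite k i
  ... | inj₁ refl = run⇒balanced 𝒫 (word k leading)
    (rounds-run-leading (a-opposite-≢ k) (m k) (m (opposite k)) {{m-pos (opposite k)}} (<-wellFounded _) leading)
    (sym (length-word k leading))
  ... | inj₂ refl = run⇒balanced 𝒫 (word k leading)
    (rounds-run-other (a-opposite-≢ k) (m k) (m (opposite k)) {{m-pos (opposite k)}} (<-wellFounded _))
    (sym (length-word k leading))

theorem1 : (𝒫 : CyclicSequencingProblem 2) →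
    let open CyclicSequencingProblem 𝒫
        open ESA 𝒫
    in (k : Fin 2) (leading : IsLeading k) →
       cycle k leading ∈ Ω × (∀ (C' : Cycle) → C' ∈ Ω → σ² (cycle k leading) ≤ σ² C')
theorem1 𝒫 k leading =
  cycle∈Ω 𝒫 k leading ,
  λ C' → balanced⇒σ²-minimal 𝒫 (cycle∈Ω 𝒫 k leading) (cycle-balanced 𝒫 k leading)
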